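{- Let $G$ be a finitely generated abelian group. Suppose that there exist $M\ge 1$ and finite non-empty sets $F_1,\dots,F_M\subset G$ such that the system of tiling equations $A\oplus F_m=G$ for all $m=1,\dots,M$ is aperiodic. Then there exist $N=2^r$ for some $r\ge 0$ and a finite non-empty subset $\tilde F$ of $G\times\mathbb{Z}/N\mathbb{Z}$ such that the single tiling equation $\tilde A\oplus\tilde F=G\times\mathbb{Z}/N\mathbb{Z}$ is aperiodic.
   Context: For an abelian group $G$ and $A,F\subset G$, $A\oplus F=G$ means that the translates $a+F$, $a\in A$, are pairwise disjoint and their union is $G$. A set $A\subset G$ is periodic if it is a finite union of cosets of a finite-index subgroup of $G$. A system of tiling equations $A\oplus F_m=G$, $m=1,\dots,M$ (with $F_m$ given and a common unknown $A\subset G$) is aperiodic if there is at least one $A$ solving all of them simultaneously, but no such $A$ is periodic; a single tiling equation is aperiodic in the same sense with $M=1$. -}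

module Defs where

open import Level using (Level; _⊔_)
open import Data.Nat using (ℕ)
open import Data.Integer using (ℤ; +_; _-_; _+_; -_)
open import Data.Integer.Divisibility using (_∣_)
open import Data.Product using (Σ; _×_; ∃; _,_)
open import Data.Sum using (_⊎_)
open import Data.List using (List; foldr; [])
import Data.Fin
open import Data.List.Relation.Unary.Any using (Any)
open import Data.List.Relation.Unary.All using (All)
open import Relation.Nullary using (¬_)
open import Algebra.Bundles using (AbelianGroup)
open import Algebra.Bundles.Raw using (RawGroup)
import Algebra.Construct.DirectProduct as DP

module Tiling {c ℓ : Level} (G : RawGroup c ℓ) where
  open RawGroup G renaming (_∙_ to _+ᴳ_; ε to 0ᴳ; _⁻¹ to -ᴳ_)

  Subset : Set (Level.suc (c ⊔ ℓ))
  Subset = Carrier → Set (c ⊔ ℓ)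

  Respects≈ : Subset → Set (c ⊔ ℓ)
  Respects≈ A = ∀ {x y} → x ≈ y → A x → A y

  _∈ᶠ_ : Carrier → List Carrier → Set (c ⊔ ℓ)
  x ∈ᶠ F = Any (λ f → x ≈ f) F

  Tiles : Subset → List Carrier → Set (c ⊔ ℓ)
  Tiles A F =
    Respects≈ A
    × (∀ g → Σ Carrier λ a → Σ Carrier λ f → A a × f ∈ᶠ F × (a +ᴳ f) ≈ g)
    × (∀ a a' f f' → A a → A a' → f ∈ᶠ F → f' ∈ᶠ F →
         (a +ᴳ f) ≈ (a' +ᴳ f') → a ≈ a')

  record Subgroup : Set (Level.suc (c ⊔ ℓ)) where
    field
      H        : Subset
      resp     : Respects≈ H
      has-0    : H 0ᴳ
      closed-+ : ∀ {x y} → H x → H y → H (x +ᴳ y)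
      closed-- : ∀ {x} → H x → H (-ᴳ x)

  FiniteIndex : Subgroup → Set (c ⊔ ℓ)
  FiniteIndex S = Σ (List Carrier) λ reps →
    ∀ g → Any (λ r → Subgroup.H S (g +ᴳ (-ᴳ r))) reps

  Periodic : Subset → Set (Level.suc (c ⊔ ℓ))
  Periodic A = Σ Subgroup λ S → FiniteIndex S × Σ (List Carrier) λ ts →
    ∀ x → (A x → Any (λ t → Subgroup.H S (x +ᴳ (-ᴳ t))) ts)
        × (Any (λ t → Subgroup.H S (x +ᴳ (-ᴳ t))) ts → A x)

  AperiodicSystem : (M : ℕ) → (Data.Fin.Fin M → List Carrier) → Set (Level.suc (c ⊔ ℓ))
  AperiodicSystem M Fs =
    (Σ Subset λ A → ∀ m → Tiles A (Fs m))
    × (∀ A → (∀ m → Tiles A (Fs m)) → ¬ Periodic A)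

  Aperiodic : List Carrier → Set (Level.suc (c ⊔ ℓ))
  Aperiodic F =
    (Σ Subset λ A → Tiles A F)
    × (∀ A → Tiles A F → ¬ Periodic A)

FinitelyGenerated : ∀ {c ℓ} → AbelianGroup c ℓ → Set (c ⊔ ℓ)
FinitelyGenerated G = Σ (List Carrier) λ gens → ∀ g →
  Σ (List Carrier) λ ws →
    All (λ w → Any (λ s → (w ≈ s) ⊎ (w ≈ (s ⁻¹))) gens) ws
    × (g ≈ foldr _∙_ ε ws)
  where open AbelianGroup G

ZMod : ℕ → RawGroup Level.zero Level.zero
ZMod N = record
  { Carrier = ℤ
  ; _≈_ = λ x y → (+ N) ∣ (x - y)
  ; _∙_ = _+_
  ; ε = + 0
  ; _⁻¹ = -_
  }

_×ℤ/_ : ∀ {c ℓ} → AbelianGroup c ℓ → ℕ → RawGroup c ℓ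
G ×ℤ/ N = DP.rawGroup (AbelianGroup.rawGroup G) (ZMod N)

{-# OPTIONS --safe #-}
module Submission where

-- Put N = 8^k with M = k + 1, colour ℤ/N with M colours, and let F̃ = ⋃ₘ Fₘ × Eₘ, where Eₘ is the
-- m-th colour class.  The fibre of a tiling by F̃ over g ∈ G is partitioned into translates of the
-- Eₘ, one of colour m for each way of writing g = a + f with (a, z) ∈ Ã and f ∈ Fₘ; if cₘ of them
-- have colour m, then Σ cₘ |Eₘ| = N.  The sizes are such that this forces cₘ = 1 for every m, so the
-- projection of Ã to G tiles with each Fₘ.  Projections of periodic sets are periodic.

open import Defs
open import Data.Nat using (ℕ; zero; suc; _≤_; _<_; _^_; _⊔_; s≤s; z≤n; NonZero)
open import Data.Fin using (Fin; zero; suc; toℕ; fromℕ<; _↑ˡ_; _↑ʳ_; _≟_)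
open import Data.Integer using (ℤ)
open import Data.Product using (Σ; _×_; _,_; proj₁; proj₂)
open import Data.List using (List; []; _∷_; map; concatMap; allFin)
open import Relation.Nullary using (¬_; yes; no; contradiction)
open import Relation.Binary.PropositionalEquality using (_≡_; _≢_; refl; sym; trans; cong; cong₂; subst; subst₂; module ≡-Reasoning)
open import Algebra.Bundles using (AbelianGroup)
open import Algebra.Bundles.Raw using (RawGroup)
import Data.Nat as ℕ
import Data.Nat.Divisibility as ℕ
open import Data.Nat.Primality using (prime?; euclidsLemma)
import Data.Nat.Properties as ℕ
open import Data.Nat.Solver using () renaming (module +-*-Solver to ℕ-Solver)
open import Data.Fin.Properties using (toℕ-injective; toℕ-fromℕ<; toℕ<n)
open import Data.Integer.DivMod using (n%ℕd<d; a≡a%ℕn+[a/ℕn]*n)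
open import Data.Integer.Divisibility.Signed using (_∣_; ∣ᵤ⇒∣; ∣⇒∣ᵤ; ∣m∣n⇒∣m+n; ∣m⇒∣-m; divides)
import Data.Integer.Properties as ℤ
open import Data.Integer.Solver using () renaming (module +-*-Solver to ℤ-Solver)
open import Data.List.Membership.Propositional using (find; lose)
open import Data.List.Relation.Unary.Any as Any using (Any; here; satisfied)
import Data.List.Relation.Unary.Any.Properties as Any
open import Data.Sum using (inj₁; inj₂)
open import Data.Vec.Functional using (Vector; replicate; _++_)
open import Data.Vec.Functional.Properties using (lookup-++ˡ; lookup-++ʳ)
open import Function using (_∘_; case_of_)
open import Relation.Nullary.Decidable using (toWitness; toWitnessFalse)
open import Algebra.Properties.CommutativeMonoid.Sum ℕ.+-0-commutativeMonoid using (sum; sum-cong-≗; ∑-comm)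

-- Sums over `Fin n` and indicator functions.

module FinSums where
  open Data.Nat using (_+_; _*_)

  sum-const : ∀ n c → sum {n} (λ _ → c) ≡ n * c
  sum-const zero    c = refl
  sum-const (suc n) c = cong (c +_) (sum-const n c)

  sum-split : ∀ m {n} (v : Vector ℕ (m + n)) → sum v ≡ sum (v ∘ (_↑ˡ n)) + sum (v ∘ (m ↑ʳ_))
  sum-split zero    v = refl
  sum-split (suc m) v = trans (cong (v zero +_) (sum-split m (v ∘ suc))) (sym (ℕ.+-assoc (v zero) _ _))

  sum-∘-++ : ∀ {A : Set} {m n} (c : A → ℕ) (xs : Vector A m) (ys : Vector A n) →
             sum (c ∘ (xs ++ ys)) ≡ sum (c ∘ xs) + sum (c ∘ ys)
  sum-∘-++ {m = m} c xs ys = trans (sum-split m _)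
    (cong₂ _+_ (sum-cong-≗ (cong c ∘ lookup-++ˡ xs ys)) (sum-cong-≗ (cong c ∘ lookup-++ʳ xs ys)))

  sum≡0⇒≡0 : ∀ {n} (v : Vector ℕ n) → sum v ≡ 0 → ∀ i → v i ≡ 0
  sum≡0⇒≡0 v eq zero    = ℕ.m+n≡0⇒m≡0 (v zero) eq
  sum≡0⇒≡0 v eq (suc i) = sum≡0⇒≡0 (v ∘ suc) (ℕ.m+n≡0⇒n≡0 (v zero) eq) i

  sum≢0⇒∃≢0 : ∀ {n} (v : Vector ℕ n) → sum v ≢ 0 → Σ (Fin n) λ i → v i ≢ 0
  sum≢0⇒∃≢0 {zero}  v ≢0 = contradiction refl ≢0
  sum≢0⇒∃≢0 {suc n} v ≢0 with v zero in eq
  ... | suc _ = zero , λ ≡0 → case trans (sym eq) ≡0 of λ ()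
  ... | zero  = let i , vi≢0 = sum≢0⇒∃≢0 (v ∘ suc) ≢0 in suc i , vi≢0

  sum≡1⇒unique : ∀ {n} (v : Vector ℕ n) → sum v ≡ 1 → ∀ {i j} → v i ≢ 0 → v j ≢ 0 → i ≡ j
  sum≡1⇒unique {suc n} v eq {i} {j} vi≢0 vj≢0 with v zero in eq₀
  ... | suc (suc _) = case eq of λ ()
  ... | zero = go i j vi≢0 vj≢0
    where
    go : ∀ i j → v i ≢ 0 → v j ≢ 0 → i ≡ j
    go zero    _       vi≢0 _    = contradiction eq₀ vi≢0
    go (suc _) zero    _    vj≢0 = contradiction eq₀ vj≢0
    go (suc i) (suc j) vi≢0 vj≢0 = cong suc (sum≡1⇒unique (v ∘ suc) eq vi≢0 vj≢0)
  ... | suc zero = trans (≡zero i vi≢0) (sym (≡zero j vj≢0))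
    where
    ≡zero : ∀ i → v i ≢ 0 → i ≡ zero
    ≡zero zero    _    = refl
    ≡zero (suc i) vi≢0 = contradiction (sum≡0⇒≡0 (v ∘ suc) (ℕ.suc-injective eq) i) vi≢0

  -- An indicator with values in `ℕ`, so that cardinalities become sums and double counting becomes
  -- `∑-comm`.
  δ : ∀ {n} → Fin n → Fin n → ℕ
  δ i j with i ≟ j
  ... | yes _ = 1
  ... | no  _ = 0

  δ-refl : ∀ {n} (i : Fin n) → δ i i ≡ 1
  δ-refl i with i ≟ i
  ... | yes _   = refl
  ... | no  i≢i = contradiction refl i≢i

  δ≢0⇒≡ : ∀ {n} {i j : Fin n} → δ i j ≢ 0 → i ≡ j
  δ≢0⇒≡ {i = i} {j} ≢0 with i ≟ j
  ... | yes i≡j = i≡j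
  ... | no  _   = contradiction refl ≢0

  δ-suc : ∀ {n} (i j : Fin n) → δ (suc i) (suc j) ≡ δ i j
  δ-suc i j with i ≟ j
  ... | yes _ = refl
  ... | no  _ = refl

  sum-δ : ∀ {n} (i : Fin n) (v : Vector ℕ n) → sum (λ j → δ i j * v j) ≡ v i
  sum-δ {suc n} zero v = trans
    (cong₂ _+_ (ℕ.*-identityˡ (v zero)) (trans (sum-const n 0) (ℕ.*-zeroʳ n)))
    (ℕ.+-identityʳ (v zero))
  sum-δ (suc i) v = trans (sum-cong-≗ (λ j → cong (_* v (suc j)) (δ-suc i j))) (sum-δ i (v ∘ suc))

open FinSums

-- A colouring whose class sizes add up to 8^k in only one way.

module Colouring where
  open Data.Nat using (_+_; _*_)

  -- The colour classes have sizes 5·8^(k-1), 3·5·8^(k-2), …, 3^(k-1)·5, 3^k.  The first exceeds half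
  -- of 8^k and the others are multiples of 3, which 8^k is not; so a sum of class sizes equal to 8^k
  -- contains the first exactly once, and the rest is 3 times such a sum for k - 1.
  colour : ∀ k → Fin (8 ^ k) → Fin (suc k)
  colour zero    _ = zero
  colour (suc k) = cs ++ (cs ++ (cs ++ replicate (5 * 8 ^ k) zero))
    where cs = suc ∘ colour k

  8^k≢0 : ∀ k → NonZero (8 ^ k)
  8^k≢0 k = ℕ.m^n≢0 8 k

  someFin : ∀ n → .{{NonZero n}} → Fin n
  someFin (suc _) = zero

  colour-surjective : ∀ k i → Σ (Fin (8 ^ k)) λ e → colour k e ≡ i
  colour-surjective zero    zero    = zero , refl
  colour-surjective (suc k) zero    =
    -- Colour `zero` fills the last block, behind three copies of `cs`; its length `5 * n` is
    -- nonzero, which provides `e`.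
    n ↑ʳ (n ↑ʳ (n ↑ʳ e)) ,
    trans (lookup-++ʳ cs _ (n ↑ʳ (n ↑ʳ e)))
      (trans (lookup-++ʳ cs _ (n ↑ʳ e)) (lookup-++ʳ cs (replicate (5 * n) zero) e))
    where
    n = 8 ^ k
    cs = suc ∘ colour k
    e = someFin (5 * n) {{ℕ.m*n≢0 5 n {{_}} {{8^k≢0 k}}}}
  colour-surjective (suc k) (suc i) =
    let e , eq = colour-surjective k i
    in e ↑ˡ _ , trans (lookup-++ˡ (suc ∘ colour k) _ e) (cong suc eq)

  sum-colour : ∀ k (c : Fin (suc (suc k)) → ℕ) → let s = sum (c ∘ suc ∘ colour k) in
               sum (c ∘ colour (suc k)) ≡ 3 * s + 5 * 8 ^ k * c zero
  sum-colour k c = begin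
    sum (c ∘ colour (suc k))                    ≡⟨ sum-∘-++ c cs _ ⟩
    s + sum (c ∘ (cs ++ (cs ++ zs)))            ≡⟨ cong (s +_) (sum-∘-++ c cs _) ⟩
    s + (s + sum (c ∘ (cs ++ zs)))              ≡⟨ cong (λ x → s + (s + x)) (sum-∘-++ c cs zs) ⟩
    s + (s + (s + sum (c ∘ zs)))                ≡⟨ cong (λ x → s + (s + (s + x))) (sum-const (5 * 8 ^ k) (c zero)) ⟩
    s + (s + (s + t))                           ≡⟨ solve 2 (λ s t → s :+ (s :+ (s :+ t)) := con 3 :* s :+ t) refl s t ⟩
    3 * s + t                                   ∎
    where
    open ≡-Reasoning
    open ℕ-Solver
    cs = suc ∘ colour k
    zs = replicate (5 * 8 ^ k) zero
    s  = sum (c ∘ cs)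
    t  = 5 * 8 ^ k * c zero

  3∤8^k : ∀ k → ¬ 3 ℕ.∣ 8 ^ k
  3∤8^k zero    = toWitnessFalse {a? = 3 ℕ.∣? 1} _
  3∤8^k (suc k) 3∣ with euclidsLemma 8 (8 ^ k) (toWitness {a? = prime? 3} _) 3∣
  ... | inj₁ 3∣8   = toWitnessFalse {a? = 3 ℕ.∣? 8} _ 3∣8
  ... | inj₂ 3∣8^k = 3∤8^k k 3∣8^k

  colour-balanced : ∀ k (c : Fin (suc k) → ℕ) → sum (c ∘ colour k) ≡ 8 ^ k → ∀ i → c i ≡ 1
  colour-balanced zero    c eq zero = trans (sym (ℕ.+-identityʳ _)) eq
  colour-balanced (suc k) c eq      = cases (c zero) refl
    where
    n = 8 ^ k
    s = sum (c ∘ suc ∘ colour k)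
    eq′ : 3 * s + 5 * n * c zero ≡ 8 * n
    eq′ = trans (sym (sum-colour k c)) eq
    open ℕ-Solver

    cases : ∀ t → c zero ≡ t → ∀ i → c i ≡ 1
    -- Without the colour `zero`, the left side of `eq′` is a multiple of 3, but the right side is a
    -- power of 8.
    cases zero c₀≡0 = contradiction (ℕ.divides s (begin
      8 * n                     ≡⟨ eq′ ⟨
      3 * s + 5 * n * c zero    ≡⟨ cong (λ t → 3 * s + 5 * n * t) c₀≡0 ⟩
      3 * s + 5 * n * 0         ≡⟨ solve 2 (λ s n → con 3 :* s :+ con 5 :* n :* con 0 := s :* con 3) refl s n ⟩
      s * 3                     ∎)) (3∤8^k (suc k))
      where open ≡-Reasoning
    cases (suc zero) c₀≡1 zero    = c₀≡1
    -- Removing `5 * n` from both sides and dividing by 3 leaves the hypothesis for `k`.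
    cases (suc zero) c₀≡1 (suc i) = colour-balanced k (c ∘ suc) (ℕ.*-cancelˡ-≡ s n 3 (ℕ.+-cancelʳ-≡ (5 * n) (3 * s) (3 * n) (begin
      3 * s + 5 * n             ≡⟨ cong (3 * s +_) (ℕ.*-identityʳ (5 * n)) ⟨
      3 * s + 5 * n * 1         ≡⟨ cong (λ t → 3 * s + 5 * n * t) c₀≡1 ⟨
      3 * s + 5 * n * c zero    ≡⟨ eq′ ⟩
      8 * n                     ≡⟨ ℕ.*-distribʳ-+ n 3 5 ⟩
      3 * n + 5 * n             ∎))) i
      where open ≡-Reasoning
    cases (suc (suc t)) c₀≡2+t = contradiction (begin-strict
      8 * n                     <⟨ ℕ.*-monoˡ-< n {{8^k≢0 k}} {8} {10} (ℕ.m<m+n 8 (s≤s z≤n)) ⟩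
      10 * n                    ≡⟨ solve 1 (λ n → con 10 :* n := con 5 :* n :* con 2) refl n ⟩
      5 * n * 2                 ≤⟨ ℕ.*-monoʳ-≤ (5 * n) (s≤s (s≤s z≤n)) ⟩
      5 * n * suc (suc t)       ≡⟨ cong (5 * n *_) c₀≡2+t ⟨
      5 * n * c zero            ≤⟨ ℕ.m≤n+m _ (3 * s) ⟩
      3 * s + 5 * n * c zero    ≡⟨ eq′ ⟩
      8 * n                     ∎) (ℕ.<-irrefl refl)
      where open ℕ.≤-Reasoning

open Colouring

-- Counting the translates of colour classes that partition `Fin N`.

module Counting {p} {M N : ℕ} (colour : Fin N → Fin M) (_⊕_ : Fin N → Fin N → Fin N)
  (P : Fin M → Fin N → Set p)
  (cover : ∀ x → Σ (Fin N) λ j → Σ (Fin N) λ e → P (colour e) j × j ⊕ e ≡ x)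
  (disjoint : ∀ {j j′ e e′} → P (colour e) j → P (colour e′) j′ → j ⊕ e ≡ j′ ⊕ e′ → j ≡ j′ × e ≡ e′)
  where

  open Data.Nat using (_*_)

  -- Read `P i j` as: the translate by `j` of colour class `i` belongs to the partition. As `P` is
  -- not assumed decidable, translates cannot be counted directly; the counts run over points `x`
  -- instead, through the decomposition that `cover` selects.
  base part : Fin N → Fin N
  base x = proj₁ (cover x)
  part x = proj₁ (proj₂ (cover x))

  P-cover : ∀ x → P (colour (part x)) (base x)
  P-cover x = proj₁ (proj₂ (proj₂ (cover x)))

  ⊕-cover : ∀ x → base x ⊕ part x ≡ x
  ⊕-cover x = proj₂ (proj₂ (proj₂ (cover x)))

  cover-⊕ : ∀ {j e} → P (colour e) j → base (j ⊕ e) ≡ j × part (j ⊕ e) ≡ e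
  cover-⊕ {j} {e} Pj = disjoint (P-cover (j ⊕ e)) Pj (⊕-cover (j ⊕ e))

  -- In effect the number of translates of the class of `e`: each of them contains exactly one point
  -- whose part is `e`.
  uses : Fin N → ℕ
  uses e = sum λ x → δ (part x) e

  -- This turns out to be 1 if `P (colour e) j` holds and 0 if not, so it is a numerical, hence
  -- decidable, substitute for `P`.
  hits : Fin N → Fin N → ℕ
  hits j e = sum λ x → δ (base x) j * δ (part x) e

  -- Double counting: every point has exactly one part.
  sum-uses : sum uses ≡ N
  sum-uses = begin
    sum (λ e → sum λ x → δ (part x) e)  ≡⟨ ∑-comm (λ e x → δ (part x) e) ⟩
    sum (λ x → sum λ e → δ (part x) e)  ≡⟨ sum-cong-≗ (λ x → sum-cong-≗ λ e → sym (ℕ.*-identityʳ (δ (part x) e))) ⟩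
    sum (λ x → sum λ e → δ (part x) e * 1)  ≡⟨ sum-cong-≗ (λ x → sum-δ (part x) (λ _ → 1)) ⟩
    sum {N} (λ _ → 1)                   ≡⟨ sum-const N 1 ⟩
    N * 1                               ≡⟨ ℕ.*-identityʳ N ⟩
    N                                   ∎
    where open ≡-Reasoning

  uses≡sum-hits : ∀ e → uses e ≡ sum λ j → hits j e
  uses≡sum-hits e = sym (trans (∑-comm (λ j x → δ (base x) j * δ (part x) e))
    (sum-cong-≗ λ x → sum-δ (base x) (λ _ → δ (part x) e)))

  -- Only the point `j ⊕ e` contributes: it does so by `cover-⊕`, and `⊕-cover` excludes every other
  -- point.
  P⇒hits≡1 : ∀ {j e} → P (colour e) j → hits j e ≡ 1
  P⇒hits≡1 {j} {e} Pj = trans (sum-cong-≗ pointwise) (sum-δ (j ⊕ e) (λ _ → 1))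
    where
    pointwise : ∀ x → δ (base x) j * δ (part x) e ≡ δ (j ⊕ e) x * 1
    pointwise x with (j ⊕ e) ≟ x
    ... | yes refl = cong₂ _*_
      (trans (cong (λ b → δ b j) (proj₁ (cover-⊕ Pj))) (δ-refl j))
      (trans (cong (λ b → δ b e) (proj₂ (cover-⊕ Pj))) (δ-refl e))
    ... | no j⊕e≢x with base x ≟ j | part x ≟ e
    ...   | no _     | _        = refl
    ...   | yes _    | no _     = refl
    ...   | yes refl | yes refl = contradiction (⊕-cover x) j⊕e≢x

  hits≢0⇒P : ∀ {j e} → hits j e ≢ 0 → P (colour e) j
  hits≢0⇒P {j} {e} ≢0 with sum≢0⇒∃≢0 _ ≢0
  ... | x , term≢0 = subst₂ (λ e j → P (colour e) j)
    (δ≢0⇒≡ λ ≡0 → term≢0 (trans (cong (δ (base x) j *_) ≡0) (ℕ.*-zeroʳ (δ (base x) j))))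
    (δ≢0⇒≡ λ ≡0 → term≢0 (cong (_* δ (part x) e) ≡0))
    (P-cover x)

  -- Both numbers are 0 or 1, and `P` sees `e` only through its colour. Comparing with 0 avoids
  -- deciding `P`.
  hits-colour : ∀ {e e′} → colour e ≡ colour e′ → ∀ j → hits j e ≡ hits j e′
  hits-colour {e} {e′} eq j with hits j e ℕ.≟ 0 | hits j e′ ℕ.≟ 0
  ... | yes ≡0 | yes ≡0′ = trans ≡0 (sym ≡0′)
  ... | no  ≢0 | _       = let Pj = hits≢0⇒P ≢0 in
    trans (P⇒hits≡1 Pj) (sym (P⇒hits≡1 (subst (λ m → P m j) eq Pj)))
  ... | yes _  | no ≢0   = let Pj = hits≢0⇒P ≢0 in
    trans (P⇒hits≡1 (subst (λ m → P m j) (sym eq) Pj)) (sym (P⇒hits≡1 Pj))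

  uses-colour : ∀ {e e′} → colour e ≡ colour e′ → uses e ≡ uses e′
  uses-colour {e} {e′} eq = trans (uses≡sum-hits e)
    (trans (sum-cong-≗ (hits-colour eq)) (sym (uses≡sum-hits e′)))

  -- A sum of indicators over `j` that equals 1 has exactly one nonzero term.
  uses≡1⇒∃! : ∀ {e} → uses e ≡ 1 →
    Σ (Fin N) λ j → P (colour e) j × (∀ {j′} → P (colour e) j′ → j ≡ j′)
  uses≡1⇒∃! {e} uses≡1 with sum≢0⇒∃≢0 (λ j → hits j e) (λ ≡0 → case trans (sym uses≡1) (trans (uses≡sum-hits e) ≡0) of λ ())
  ... | j , ≢0 = j , hits≢0⇒P ≢0 , λ Pj′ →
    sum≡1⇒unique (λ j → hits j e) (trans (sym (uses≡sum-hits e)) uses≡1) ≢0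
      λ ≡0 → case trans (sym ≡0) (P⇒hits≡1 Pj′) of λ ()

-- Integers modulo `N` and their representatives in `Fin N`.

module Residues (N : ℕ) {{_ : NonZero N}} where

  open Data.Integer using (+_; _+_; _*_; _-_; -_; ∣_∣; _%ℕ_; _/ℕ_)

  infix 4 _≋_
  -- Being a record, it lets `x` and `y` be inferred, while the equality of `ZMod` unfolds to a
  -- divisibility of absolute values.
  record _≋_ (x y : ℤ) : Set where
    constructor mod-N
    field difference : + N ∣ (x - y)

  ≋-sym : ∀ {x y} → x ≋ y → y ≋ x
  ≋-sym {x} {y} (mod-N d) = mod-N (subst (+ N ∣_)
    (solve 2 (λ x y → :- (x :- y) := y :- x) refl x y)
    (∣m⇒∣-m d))
    where open ℤ-Solver

  ≋-trans : ∀ {x y z} → x ≋ y → y ≋ z → x ≋ z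
  ≋-trans {x} {y} {z} (mod-N d) (mod-N d′) = mod-N (subst (+ N ∣_)
    (solve 3 (λ x y z → (x :- y) :+ (y :- z) := x :- z) refl x y z)
    (∣m∣n⇒∣m+n d d′))
    where open ℤ-Solver

  ≋-+-cong : ∀ {x y u v} → x ≋ y → u ≋ v → x + u ≋ y + v
  ≋-+-cong {x} {y} {u} {v} (mod-N d) (mod-N d′) = mod-N (subst (+ N ∣_)
    (solve 4 (λ x y u v → (x :- y) :+ (u :- v) := (x :+ u) :- (y :+ v)) refl x y u v)
    (∣m∣n⇒∣m+n d d′))
    where open ℤ-Solver

  ≋-+-cancelˡ : ∀ x {u v} → x + u ≋ x + v → u ≋ v
  ≋-+-cancelˡ x {u} {v} (mod-N d) = mod-N (subst (+ N ∣_)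
    (solve 3 (λ x u v → (x :+ u) :- (x :+ v) := u :- v) refl x u v) d)
    where open ℤ-Solver

  int : Fin N → ℤ
  int e = + toℕ e

  -- Two representatives differ by less than `N`, and 0 is the only multiple of `N` that small.
  int-injective : ∀ {e e′} → int e ≋ int e′ → e ≡ e′
  int-injective {e} {e′} (mod-N d) =
    toℕ-injective (ℤ.+-injective (ℤ.i-j≡0⇒i≡j _ _ (ℤ.∣i∣≡0⇒i≡0 (multiple-below-N (∣⇒∣ᵤ d) bound))))
    where
    bound : ∣ int e - int e′ ∣ < N
    bound = ℕ.≤-<-trans
      (subst (λ i → ∣ i ∣ ≤ toℕ e ⊔ toℕ e′) (sym (ℤ.m-n≡m⊖n (toℕ e) (toℕ e′))) (ℤ.∣m⊝n∣≤m⊔n (toℕ e) (toℕ e′)))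
      (ℕ.⊔-pres-<m (toℕ<n e) (toℕ<n e′))
    multiple-below-N : ∀ {n} → N ℕ.∣ n → n < N → n ≡ 0
    multiple-below-N {zero}  _   _   = refl
    multiple-below-N {suc _} N∣n n<N = contradiction N∣n (ℕ.>⇒∤ n<N)

  abstract
    residue : ℤ → Fin N
    residue x = fromℕ< (n%ℕd<d x N)

    int-residue : ∀ x → int (residue x) ≋ x
    int-residue x = ≋-sym (mod-N (divides (x /ℕ N) (begin
      x - int (residue x)                           ≡⟨ cong (λ r → x - + r) (toℕ-fromℕ< _) ⟩
      x - + (x %ℕ N)                                ≡⟨ cong (_- + (x %ℕ N)) (a≡a%ℕn+[a/ℕn]*n x N) ⟩
      (+ (x %ℕ N) + (x /ℕ N) * + N) - + (x %ℕ N)    ≡⟨ solve 2 (λ r q → r :+ q :- r := q) refl (+ (x %ℕ N)) ((x /ℕ N) * + N) ⟩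
      (x /ℕ N) * + N                                ∎)))
      where
      open ≡-Reasoning
      open ℤ-Solver

  residue-cong : ∀ {x y} → x ≋ y → residue x ≡ residue y
  residue-cong {x} {y} x≋y = int-injective (≋-trans (int-residue x) (≋-trans x≋y (≋-sym (int-residue y))))

  infix 4 _≈ᴺ_
  _≈ᴺ_ : ℤ → ℤ → Set
  _≈ᴺ_ = RawGroup._≈_ (ZMod N)

  -- With its converse below, this trades equality in ℤ/N for propositional equality in `Fin N`,
  -- which can be matched on and counted.
  ≈ᴺ⇒residue≡ : ∀ x y → x ≈ᴺ y → residue x ≡ residue y
  ≈ᴺ⇒residue≡ x y x≈y = residue-cong {x} {y} (mod-N (∣ᵤ⇒∣ x≈y))

  residue≡⇒≈ᴺ : ∀ x y → residue x ≡ residue y → x ≈ᴺ y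
  residue≡⇒≈ᴺ x y eq = ∣⇒∣ᵤ (_≋_.difference
    (≋-trans (≋-sym (int-residue x)) (subst (λ r → int r ≋ y) (sym eq) (int-residue y))))

  residue-int : ∀ e → residue (int e) ≡ e
  residue-int e = int-injective (int-residue (int e))

  infixl 6 _⊕_
  _⊕_ : Fin N → Fin N → Fin N
  j ⊕ e = residue (int j + int e)

  residue-+ : ∀ x y → residue (x + y) ≡ residue x ⊕ residue y
  residue-+ x y = sym (residue-cong (≋-+-cong (int-residue x) (int-residue y)))

  ⊕-cancelˡ : ∀ j {e e′} → j ⊕ e ≡ j ⊕ e′ → e ≡ e′
  ⊕-cancelˡ j {e} {e′} eq = int-injective (≋-+-cancelˡ (int j) (mod-N (∣ᵤ⇒∣ (residue≡⇒≈ᴺ (int j + int e) (int j + int e′) eq))))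

-- The stacked tile in G × ℤ/N.

module Stacking {c ℓ} (G : AbelianGroup c ℓ) {M N : ℕ} {{_ : NonZero N}}
  (colour : Fin N → Fin M)
  (colour-surjective : ∀ i → Σ (Fin N) λ e → colour e ≡ i)
  (colour-balanced : ∀ (w : Fin M → ℕ) → sum (w ∘ colour) ≡ N → ∀ i → w i ≡ 1)
  (Fs : Fin M → List (AbelianGroup.Carrier G))
  where

  open AbelianGroup G using (Carrier; _∙_; _≈_)
  open Data.Integer using (+_; _+_; _-_; -_)
  module G = AbelianGroup G
  module G̃ = RawGroup (G ×ℤ/ N)
  module TG = Tiling G.rawGroup
  module TZ = Tiling (G ×ℤ/ N)
  open Residues N

  -- The union of the Fₘ × Eₘ, listed by height: the slice at height `e` is the tile of the colour
  -- of `e`.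
  stack : List (Carrier × ℤ)
  stack = concatMap (λ e → map (_, int e) (Fs (colour e))) (allFin N)

  ∈-stack⁺ : ∀ {f y} e → f TG.∈ᶠ Fs (colour e) → residue y ≡ e → (f , y) TZ.∈ᶠ stack
  ∈-stack⁺ {f} {y} e f∈ eq = Any.concatMap⁺ (λ e → map (_, int e) (Fs (colour e)))
    (Any.tabulate⁺ e (Any.map⁺ (Any.map (_, residue≡⇒≈ᴺ y (int e) (trans eq (sym (residue-int e)))) f∈)))

  ∈-stack⁻ : ∀ {f y} → (f , y) TZ.∈ᶠ stack → Σ (Fin N) λ e → f TG.∈ᶠ Fs (colour e) × residue y ≡ e
  ∈-stack⁻ {f} {y} f∈ with satisfied (Any.concatMap⁻ (λ e → map (_, int e) (Fs (colour e))) {xs = allFin N} f∈)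
  ... | e , any = e , Any.map proj₁ any′ ,
    trans (≈ᴺ⇒residue≡ y (int e) (proj₂ (proj₂ (satisfied any′)))) (residue-int e)
    where any′ = Any.map⁻ any

  -- From a solution of the system to a tiling by `stack`.

  groundLayer : TG.Subset → TZ.Subset
  groundLayer A (a , z) = A a × residue z ≡ residue (+ 0)

  -- With `A` at height 0, the layer at height `y` receives only the translates of
  -- `Fs (colour (residue y))`, so each layer is one equation of the system.
  groundLayer-tiles : ∀ {A} → (∀ m → TG.Tiles A (Fs m)) → TZ.Tiles (groundLayer A) stack
  groundLayer-tiles {A} tiles = respects , covers , injective
    where
    residue-0+ : ∀ z y → residue z ≡ residue (+ 0) → residue (z + y) ≡ residue y
    residue-0+ z y z≡0 = begin
      residue (z + y)               ≡⟨ residue-+ z y ⟩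
      residue z ⊕ residue y         ≡⟨ cong (_⊕ residue y) z≡0 ⟩
      residue (+ 0) ⊕ residue y     ≡⟨ residue-+ (+ 0) y ⟨
      residue (+ 0 + y)             ≡⟨ cong residue (ℤ.+-identityˡ y) ⟩
      residue y                     ∎
      where open ≡-Reasoning

    respects : TZ.Respects≈ (groundLayer A)
    respects {_ , z} {_ , z′} (a≈a′ , z≈z′) (Aa , z≡0) =
      -- A default index: each `tiles m` says that `A` respects `≈`.
      proj₁ (tiles (colour (residue z))) a≈a′ Aa , trans (sym (≈ᴺ⇒residue≡ z z′ z≈z′)) z≡0

    covers : ∀ g → Σ (Carrier × ℤ) λ a → Σ (Carrier × ℤ) λ f →
             groundLayer A a × f TZ.∈ᶠ stack × (a G̃.∙ f) G̃.≈ g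
    covers (g , y) =
      let e = residue y
          a , f , Aa , f∈ , a∙f≈g = proj₁ (proj₂ (tiles (colour e))) g
      in (a , + 0) , (f , y) , (Aa , refl) , ∈-stack⁺ e f∈ refl , a∙f≈g ,
         residue≡⇒≈ᴺ (+ 0 + y) y (residue-0+ (+ 0) y refl)

    injective : ∀ a a′ f f′ → groundLayer A a → groundLayer A a′ → f TZ.∈ᶠ stack → f′ TZ.∈ᶠ stack →
                (a G̃.∙ f) G̃.≈ (a′ G̃.∙ f′) → a G̃.≈ a′
    injective (a , z) (a′ , z′) (f , y) (f′ , y′) (Aa , z≡0) (Aa′ , z′≡0) f∈ f′∈ (eq , z+y≈) =
      let e , f∈Fs , y≡e = ∈-stack⁻ f∈
          e′ , f′∈Fs , y′≡e′ = ∈-stack⁻ f′∈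
          e′≡e = trans (sym y′≡e′) (trans (sym y≡y′) y≡e)
      in proj₂ (proj₂ (tiles (colour e))) a a′ f f′ Aa Aa′ f∈Fs
           (subst (λ e → f′ TG.∈ᶠ Fs (colour e)) e′≡e f′∈Fs) eq ,
         residue≡⇒≈ᴺ z z′ (trans z≡0 (sym z′≡0))
      where
      y≡y′ : residue y ≡ residue y′
      y≡y′ = trans (sym (residue-0+ z y z≡0))
        (trans (≈ᴺ⇒residue≡ (z + y) (z′ + y′) z+y≈) (residue-0+ z′ y′ z′≡0))

  -- From a tiling by `stack` back to the system.

  project : TZ.Subset → TG.Subset
  project Ã a = Σ ℤ λ z → Ã (a , z)

  -- The count is applied to the fibre over each `g`. Existence of a translate of colour `m` there
  -- gives the covering by `Fs m`, and its uniqueness gives the disjointness.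
  project-tiles : ∀ {Ã} → TZ.Tiles Ã stack → ∀ m → TG.Tiles (project Ã) (Fs m)
  project-tiles {Ã} (respects , covers , injective) m with colour-surjective m
  -- Matching `refl` turns `m` into `colour eₘ`, the form in which `Counting` speaks of colours.
  ... | eₘ , refl = (λ a≈a′ (z , Ãa) → z , respects (a≈a′ , residue≡⇒≈ᴺ z z refl) Ãa) , covers′ , injective′
    where
    Over : Carrier → Fin M → Fin N → Set _
    Over g i j = Σ Carrier λ a → Σ ℤ λ z → Σ Carrier λ f →
      Ã (a , z) × f TG.∈ᶠ Fs i × (a ∙ f) ≈ g × residue z ≡ j

    -- Both data write the point of height `j ⊕ e` over `g` as an element of `Ã` plus one of
    -- `stack`. The conclusion on `a` is kept for `injective′`.
    Over-unique : ∀ {g e e′ j j′} (o : Over g (colour e) j) (o′ : Over g (colour e′) j′) →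
                  j ⊕ e ≡ j′ ⊕ e′ → proj₁ o ≈ proj₁ o′ × j ≡ j′
    Over-unique {g} {e} {e′} (a , z , f , Ãa , f∈ , a∙f≈g , refl) (a′ , z′ , f′ , Ãa′ , f′∈ , a′∙f′≈g , refl) eq =
      let a≈a′ , z≈z′ = injective (a , z) (a′ , z′) (f , int e) (f′ , int e′) Ãa Ãa′
            (∈-stack⁺ e f∈ (residue-int e)) (∈-stack⁺ e′ f′∈ (residue-int e′))
            (G.trans a∙f≈g (G.sym a′∙f′≈g) , residue≡⇒≈ᴺ (z + int e) (z′ + int e′) (begin
              residue (z + int e)              ≡⟨ residue-+ z (int e) ⟩
              residue z ⊕ residue (int e)      ≡⟨ cong (residue z ⊕_) (residue-int e) ⟩
              residue z ⊕ e                    ≡⟨ eq ⟩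
              residue z′ ⊕ e′                  ≡⟨ cong (residue z′ ⊕_) (residue-int e′) ⟨
              residue z′ ⊕ residue (int e′)    ≡⟨ residue-+ z′ (int e′) ⟨
              residue (z′ + int e′)            ∎))
      in a≈a′ , ≈ᴺ⇒residue≡ z z′ z≈z′
      where open ≡-Reasoning

    Over-cover : ∀ g x → Σ (Fin N) λ j → Σ (Fin N) λ e → Over g (colour e) j × j ⊕ e ≡ x
    Over-cover g x =
      let (a , z) , (f , y) , Ãa , f∈ , a∙f≈g , z+y≈x = covers (g , int x)
          e , f∈Fs , y≡e = ∈-stack⁻ f∈
      in residue z , e , (a , z , f , Ãa , f∈Fs , a∙f≈g , refl) , (begin
        residue z ⊕ e           ≡⟨ cong (residue z ⊕_) y≡e ⟨
        residue z ⊕ residue y   ≡⟨ residue-+ z y ⟨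
        residue (z + y)         ≡⟨ ≈ᴺ⇒residue≡ (z + y) (int x) z+y≈x ⟩
        residue (int x)         ≡⟨ residue-int x ⟩
        x                       ∎)
      where open ≡-Reasoning

    Over-disjoint : ∀ {g j j′ e e′} → Over g (colour e) j → Over g (colour e′) j′ →
                    j ⊕ e ≡ j′ ⊕ e′ → j ≡ j′ × e ≡ e′
    Over-disjoint {j = j} o o′ eq with proj₂ (Over-unique o o′ eq)
    ... | refl = refl , ⊕-cancelˡ j eq

    Over-∃! : ∀ g → Σ (Fin N) λ j → Over g m j × (∀ {j′} → Over g m j′ → j ≡ j′)
    Over-∃! g = uses≡1⇒∃! uses-eₘ
      where
      open Counting colour _⊕_ (Over g) (Over-cover g) Over-disjoint
      -- `colour-balanced` takes weights on colours, so `uses` is read off at a representative of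
      -- each colour; by `uses-colour` the choice does not matter.
      rep : Fin M → Fin N
      rep i = proj₁ (colour-surjective i)
      uses-rep : ∀ e → uses (rep (colour e)) ≡ uses e
      uses-rep e = uses-colour (proj₂ (colour-surjective (colour e)))
      uses-eₘ : uses eₘ ≡ 1
      uses-eₘ = trans (sym (uses-rep eₘ))
        (colour-balanced (uses ∘ rep) (trans (sum-cong-≗ uses-rep) sum-uses) m)

    covers′ : ∀ g → Σ Carrier λ a → Σ Carrier λ f → project Ã a × f TG.∈ᶠ Fs m × (a ∙ f) ≈ g
    covers′ g = let _ , (a , z , f , Ãa , f∈ , a∙f≈g , _) , _ = Over-∃! g
                in a , f , (z , Ãa) , f∈ , a∙f≈g

    injective′ : ∀ a a′ f f′ → project Ã a → project Ã a′ → f TG.∈ᶠ Fs m → f′ TG.∈ᶠ Fs m →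
                 (a ∙ f) ≈ (a′ ∙ f′) → a ≈ a′
    injective′ a a′ f f′ (z , Ãa) (z′ , Ãa′) f∈ f′∈ eq =
      -- Both pairs are decompositions of the same point `a′ ∙ f′` with colour `m`, so they share
      -- one height `j`.
      let o  = a , z , f , Ãa , f∈ , eq , refl
          o′ = a′ , z′ , f′ , Ãa′ , f′∈ , G.refl , refl
          _ , _ , j≡ = Over-∃! (a′ ∙ f′)
      in proj₁ (Over-unique {e = eₘ} {eₘ} o o′ (cong (_⊕ eₘ) (trans (sym (j≡ o)) (j≡ o′))))

  -- The subgroup, its coset representatives and the cosets that make up `Ã` all project to G.
  project-periodic : ∀ {Ã} → TZ.Periodic Ã → TG.Periodic (project Ã)
  project-periodic {Ã} (S , (reps , reps-cover) , ts , Ã-cosets) =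
    record
      { H        = project H
      ; resp     = λ x≈y (z , Hx) → z , resp (x≈y , residue≡⇒≈ᴺ z z refl) Hx
      ; has-0    = + 0 , has-0
      ; closed-+ = λ (z , Hx) (z′ , Hy) → z + z′ , closed-+ Hx Hy
      ; closed-- = λ (z , Hx) → - z , closed-- Hx
      } ,
    (map proj₁ reps , λ g → Any.map⁺ (Any.map (λ {r} Hgr → - proj₂ r , H0- Hgr) (reps-cover (g , + 0)))) ,
    map proj₁ ts , λ x →
      (λ (z , Ãx) → Any.map⁺ (Any.map (λ {t} Hxt → z - proj₂ t , Hxt) (proj₁ (Ã-cosets (x , z)) Ãx))) ,
      λ any → from x (Any.map⁻ any)
    where
    open TZ.Subgroup S
    H0- : ∀ {x z} → H (x , + 0 - z) → H (x , - z)
    H0- {x} {z} = subst (λ z → H (x , z)) (ℤ.+-identityˡ (- z))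
    from : ∀ x → Any (λ t → project H (x ∙ proj₁ t G.⁻¹)) ts → project Ã x
    from x any with find any
    -- Here `k` is a height at which `H` contains the difference of `x` and `t`, so the point over
    -- `x` at height `k + u` lies in the coset of `(t , u)`.
    ... | (t , u) , t∈ts , k , Hxt = k + u , proj₂ (Ã-cosets (x , k + u)) (lose t∈ts
      (subst (λ z → H (x ∙ t G.⁻¹ , z)) (solve 2 (λ k u → k := k :+ u :- u) refl k u) Hxt))
      where open ℤ-Solver

  stack-aperiodic : TG.AperiodicSystem M Fs → TZ.Aperiodic stack
  stack-aperiodic ((A , tiles) , no-periodic) =
    (groundLayer A , groundLayer-tiles tiles) ,
    λ Ã Ã-tiles Ã-periodic → no-periodic (project Ã) (project-tiles Ã-tiles) (project-periodic Ã-periodic)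

  stack≢[] : ∀ i → ¬ (Fs i ≡ []) → ¬ (stack ≡ [])
  stack≢[] i Fs≢[] stack≡[] with colour-surjective i
  ... | e , refl with Fs (colour e) in eq
  ...   | []    = Fs≢[] refl
  ...   | f ∷ _ = contradiction
    (subst ((f , int e) TZ.∈ᶠ_) stack≡[]
      (∈-stack⁺ e (subst (f TG.∈ᶠ_) (sym eq) (here G.refl)) (residue-int e)))
    λ ()

theorem3p1 : ∀ {c ℓ} (G : AbelianGroup c ℓ) → FinitelyGenerated G →
    (M : ℕ) → 1 ≤ M → (Fs : Fin M → List (AbelianGroup.Carrier G)) →
    (∀ m → ¬ (Fs m ≡ [])) →
    Tiling.AperiodicSystem (AbelianGroup.rawGroup G) M Fs →
    Σ ℕ λ r → Σ (List (AbelianGroup.Carrier G × ℤ)) λ F̃ →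
    ¬ (F̃ ≡ []) × Tiling.Aperiodic (G ×ℤ/ (2 ^ r)) F̃
theorem3p1 G _ (suc k) _ Fs Fs≢[] aperiodic = 3 ℕ.* k , stack ,
  stack≢[] zero (Fs≢[] zero) ,
  -- The modulus 8^k is (2^3)^k, hence 2^(3k). The carrier is ℤ for every modulus, so the list stays
  -- the same and only its property is transported.
  subst (λ N → Tiling.Aperiodic (G ×ℤ/ N) stack) (ℕ.^-*-assoc 2 3 k) (stack-aperiodic aperiodic)
  where open Stacking G {{8^k≢0 k}} (colour k) (colour-surjective k) (colour-balanced k) Fs
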